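{- There are infinitely many finite transitive permutation groups $G\leqslant\mathrm{Sym}(\Omega)$ which admit a product decomposition and satisfy $\rho(G,\Omega)>\sqrt{|\Omega|}$.
   Context: Let $G\leqslant\mathrm{Sym}(\Omega)$ be a finite transitive permutation group. Elements $x,y\in G$ intersect if some $\alpha\in\Omega$ satisfies $\alpha^{xy^{ -1}}=\alpha$; a subset $S\subseteq G$ is an intersecting set if every two elements of $S$ intersect; it is maximum if it has the largest possible size among intersecting sets. $\rho(G,\Omega)$ denotes $|S|/|G_\omega|$ where $S$ is a maximum intersecting set and $G_\omega$ is a point stabilizer. A permutation group $G\leqslant\mathrm{Sym}(\Omega)$ admits a product decomposition if there are permutation groups $H\leqslant\mathrm{Sym}(\Delta)$ and $K\leqslant\mathrm{Sym}(\Theta)$ with $|\Delta|\ge 2$, $|\Theta|\geq 2$, such that $G$ is permutation equivalent to the wreath product $H\wr K$ in its product action on $\Delta^{\Theta}$. -}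

module Defs where

open import Data.Nat using (ℕ; _≤_; _<_; _*_)
open import Data.Fin using (Fin; _≟_)
open import Data.Fin.Permutation using (Permutation′; _⟨$⟩ʳ_; _⟨$⟩ˡ_; _∘ₚ_)
import Data.Fin.Permutation as P
open import Data.Vec using (Vec; lookup)
open import Data.List using (List; length; filter)
open import Data.List.Relation.Unary.Any using (Any)
open import Data.List.Relation.Unary.AllPairs using (AllPairs)
open import Data.List.Membership.Propositional using (_∈_)
open import Data.Product using (Σ; _×_; ∃; ∃-syntax)
open import Function.Bundles using (_↔_; Inverse)
open import Relation.Binary.PropositionalEquality using (_≡_)
open import Relation.Nullary using (¬_)

_≈ₚ_ : ∀ {n} → Permutation′ n → Permutation′ n → Set
g ≈ₚ h = ∀ α → g ⟨$⟩ʳ α ≡ h ⟨$⟩ʳ α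

record PermGroup (n : ℕ) : Set where
  field
    elems    : List (Permutation′ n)
    distinct : AllPairs (λ g h → ¬ (g ≈ₚ h)) elems
    hasId    : Any (λ g → g ≈ₚ P.id) elems
    closed∘  : ∀ {g h} → g ∈ elems → h ∈ elems → Any (λ k → k ≈ₚ (g ∘ₚ h)) elems
    closed⁻¹ : ∀ {g} → g ∈ elems → Any (λ k → k ≈ₚ P.flip g) elems
open PermGroup public

_∈G_ : ∀ {n} → Permutation′ n → PermGroup n → Set
g ∈G G = Any (λ h → h ≈ₚ g) (elems G)

Transitive : ∀ {n} → PermGroup n → Set
Transitive {n} G = ∀ (α β : Fin n) → ∃[ g ] (g ∈G G × g ⟨$⟩ʳ α ≡ β)

stabSize : ∀ {n} → PermGroup n → Fin n → ℕ
stabSize G ω = length (filter (λ g → g ⟨$⟩ʳ ω ≟ ω) (elems G))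

-- x and y intersect: some α with α^{x y⁻¹} = α (right actions: apply x, then y⁻¹)
Intersect : ∀ {n} → Permutation′ n → Permutation′ n → Set
Intersect {n} x y = ∃[ α ] (y ⟨$⟩ˡ (x ⟨$⟩ʳ α) ≡ α)

IntersectingSet : ∀ {n} → PermGroup n → List (Permutation′ n) → Set
IntersectingSet G S =
  (∀ {x} → x ∈ S → x ∈G G)
  × AllPairs (λ x y → ¬ (x ≈ₚ y)) S
  × (∀ {x y} → x ∈ S → y ∈ S → Intersect x y)

MaximumIntersectingSet : ∀ {n} → PermGroup n → List (Permutation′ n) → Set
MaximumIntersectingSet G S =
  IntersectingSet G S × (∀ T → IntersectingSet G T → length T ≤ length S)

-- ρ(G,Ω) > √|Ω| , with ρ = |S| / |G_ω|, written without roots/division: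
-- |S|² > |Ω| · |G_ω|²   (for a maximum intersecting set S, at every ω)
RhoGtSqrtDegree : ∀ {n} → PermGroup n → Set
RhoGtSqrtDegree {n} G =
  ∃[ S ] (MaximumIntersectingSet G S
          × (∀ ω → n * (stabSize G ω * stabSize G ω) < length S * length S))

-- The product action of H ≀ K on Δ^Θ with Δ = Fin m, Θ = Fin k,
-- points of Δ^Θ being vectors. The element (h_θ)_θ σ sends δ to δ'
-- with δ'_{θ^σ} = δ_θ^{h_θ}.
WreathActs : ∀ {m k} → (Fin k → Permutation′ m) → Permutation′ k
           → (Vec (Fin m) k → Vec (Fin m) k) → Set
WreathActs {m} {k} hs σ f =
  ∀ (v : Vec (Fin m) k) (θ : Fin k) → lookup (f v) (σ ⟨$⟩ʳ θ) ≡ hs θ ⟨$⟩ʳ lookup v θ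

PermEquivWreath : ∀ {n m k} → PermGroup n → PermGroup m → PermGroup k → Set
PermEquivWreath {n} {m} {k} G H K =
  Σ (Fin n ↔ Vec (Fin m) k) λ φ →
    let conj : Permutation′ n → Vec (Fin m) k → Vec (Fin m) k
        conj g v = Inverse.to φ (g ⟨$⟩ʳ Inverse.from φ v)
    in (∀ {g} → g ∈G G →
          ∃[ hs ] ((∀ θ → hs θ ∈G H) × ∃[ σ ] (σ ∈G K × WreathActs hs σ (conj g))))
     × (∀ (hs : Fin k → Permutation′ m) (σ : Permutation′ k) →
          (∀ θ → hs θ ∈G H) → σ ∈G K →
          ∃[ g ] (g ∈G G × WreathActs hs σ (conj g)))

ProductDecomposition : ∀ {n} → PermGroup n → Set
ProductDecomposition {n} G =
  ∃[ m ] ∃[ k ] (2 ≤ m × 2 ≤ k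
    × Σ (PermGroup m) λ H → Σ (PermGroup k) λ K → PermEquivWreath G H K)

{-# OPTIONS --safe #-}

-- Let H = 3³:A₄ act on 𝔽₃³, where 2² ≤ A₄ changes two signs at a time and C₃ ≤ A₄ cycles the
-- coordinates. Then H permutes the 18 affine planes x_{i+1} = ± x_{i+2} + c transitively, and
-- point stabilizers have order 18. Every element of the normal subgroup M = 3³:2², of order 108, fixes
-- one of these planes: for translations this is because two coordinates of a vector of 𝔽₃³ always agree
-- up to sign, and an element with linear part diag(1, -1, -1) acts on the three parallel planes
-- x₁ = x₂ + c as a reflection c ↦ t - c. So M is intersecting, while the coordinate 3-cycles generate a
-- semiregular subgroup of order 3, and the clique-coclique bound shows that M is maximum. Hence
-- ρ(H) = 108/18 = 6 > √18.
-- All these data multiply in Hᵏ = H ≀ 1 acting on 18ᵏ points, so ρ(Hᵏ) = 6ᵏ > √(18ᵏ).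
module Submission where

open import Defs
open import Data.Nat using (ℕ; zero; suc; _+_; _*_; _^_; _≤_; _<_; z≤n; s≤s; z<s; NonZero)
import Data.Nat as ℕ
open import Data.Nat.Properties
  using (≤-refl; ≤-trans; ≤-reflexive; ≤-<-trans; <-trans; m≤n+m; *-cancelʳ-≤; ^-monoˡ-<; ^-monoʳ-<)
open import Data.Nat.Tactic.RingSolver using (solve-∀)
open import Data.Fin using (Fin; zero; suc; toℕ; combine; remQuot; _≟_)
open import Data.Fin.Patterns using (0F; 1F; 2F)
open import Data.Fin.Properties
  using (all?; any?; *↔×; combine-remQuot; combine-injective; combine-surjective; injective⇒≤)
open import Data.Fin.Permutation
  using (Permutation′; _⟨$⟩ʳ_; _⟨$⟩ˡ_; _∘ₚ_; inverseˡ; inverseʳ)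
import Data.Fin.Permutation as P
open import Data.Vec using (Vec; []; _∷_; lookup; uncons)
import Data.Vec.Functional as Vector
open import Data.List
  using (List; []; _∷_; _++_; length; map; filter; foldr; replicate; allFin; cartesianProduct;
         cartesianProductWith)
import Data.List as List
open import Data.List.Properties
  using (length-map; length-++; filter-++; filter-accept; filter-reject)
open import Data.List.Membership.Propositional using (_∈_; find; lose)
open import Data.List.Membership.Propositional.Properties
  using (∈-map⁺; ∈-map⁻; ∈-allFin; ∈-lookup; ∈-cartesianProduct⁺; ∈-cartesianProduct⁻;
         ∈-cartesianProductWith⁻)
open import Data.List.Relation.Unary.All as All using (All)
open import Data.List.Relation.Unary.AllPairs as AllPairs using (AllPairs; []; _∷_)
import Data.List.Relation.Unary.AllPairs.Properties as AllPairs
open import Data.List.Relation.Unary.Any as Any using (Any; here; there)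
import Data.List.Relation.Unary.Any.Properties as Any
open import Data.List.Relation.Unary.Unique.Propositional using (Unique)
import Data.List.Relation.Unary.Unique.Propositional.Properties as Unique
import Data.List.Relation.Unary.Unique.Setoid.Properties as UniqueSetoid
open import Data.Product using (Σ; _×_; _,_; proj₁; proj₂; ∃; ∃-syntax; uncurry)
open import Data.Product.Function.NonDependent.Propositional using (_×-↔_)
open import Data.Product.Properties using (≡-dec)
open import Function using (_∘_; _↔_; mk↔ₛ′; Inverse)
open import Function.Construct.Composition using (_↔-∘_)
open import Function.Construct.Identity using (↔-id)
open import Function.Construct.Symmetry using (↔-sym)
open import Level using (0ℓ)
open import Relation.Binary using (Setoid)
open import Relation.Binary.PropositionalEquality
  using (_≡_; _≗_; refl; sym; trans; cong; cong₂; subst₂; module ≡-Reasoning)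
open import Relation.Nullary using (¬_; Dec; yes; no; contradiction)
open import Relation.Nullary.Decidable using (map′; toWitness; _×-dec_; _→-dec_)
open import Relation.Unary using (Pred; Decidable)

open Inverse using (to; from; strictlyInverseˡ; strictlyInverseʳ)

private
  variable
    A B C : Set
    k m n s s′ t t′ : ℕ

-- Bijections up to pointwise equality, and their conjugation

-- On Fin n this unfolds to _≈ₚ_.
infix 4 _≈_
_≈_ : A ↔ B → A ↔ B → Set
p ≈ q = to p ≗ to q

≈-setoid : ℕ → Setoid 0ℓ 0ℓ
≈-setoid n = record
  { Carrier       = Permutation′ n
  ; _≈_           = _≈ₚ_
  ; isEquivalence = record
    { refl  = λ _ → refl
    ; sym   = λ p≈q α → sym (p≈q α)
    ; trans = λ p≈q q≈r α → trans (p≈q α) (q≈r α)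
    }
  }

conj : A ↔ B → B ↔ B → A ↔ A
conj e p = ↔-sym e ↔-∘ (p ↔-∘ e)

conj-cong : (e : A ↔ B) {p q : B ↔ B} → p ≈ q → conj e p ≈ conj e q
conj-cong e p≈q a = cong (from e) (p≈q (to e a))

to-conj : (e : A ↔ B) (p : B ↔ B) → ∀ a → to e (to (conj e p) a) ≡ to p (to e a)
to-conj e p a = strictlyInverseˡ e (to p (to e a))

conj-∘ : (e : A ↔ B) (p q : B ↔ B) → conj e (q ↔-∘ p) ≈ conj e q ↔-∘ conj e p
conj-∘ e p q a = cong (from e ∘ to q) (sym (to-conj e p a))

conj-from : (e : A ↔ B) (p : B ↔ B) → ∀ b → to (conj e p) (from e b) ≡ from e (to p b)
conj-from e p b = cong (from e ∘ to p) (strictlyInverseˡ e b)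

conj-injective : (e : A ↔ B) {p q : B ↔ B} → conj e p ≈ conj e q → p ≈ q
conj-injective e {p} {q} eq b = begin
  to p b                                  ≡⟨ strictlyInverseˡ e (to p b) ⟨
  to e (from e (to p b))                  ≡⟨ cong (to e) (conj-from e p b) ⟨
  to e (to (conj e p) (from e b))         ≡⟨ cong (to e) (eq (from e b)) ⟩
  to e (to (conj e q) (from e b))         ≡⟨ cong (to e) (conj-from e q b) ⟩
  to e (from e (to q b))                  ≡⟨ strictlyInverseˡ e (to q b) ⟩
  to q b                                  ∎
  where open ≡-Reasoning

-- Permutation groups

-- `Intersect` with the inverse cleared away. In this form the relation can be read off
-- componentwise in products and decided by comparing two images.
Agree : Permutation′ n → Permutation′ n → Set
Agree {n} x y = ∃[ α ] (x ⟨$⟩ʳ α ≡ y ⟨$⟩ʳ α)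

Intersect⇒Agree : (x y : Permutation′ n) → Intersect x y → Agree x y
Intersect⇒Agree x y (α , y⁻¹xα≡α) = α , trans (sym (inverseʳ y)) (cong (y ⟨$⟩ʳ_) y⁻¹xα≡α)

Agree⇒Intersect : (x y : Permutation′ n) → Agree x y → Intersect x y
Agree⇒Intersect x y (α , xα≡yα) = α , trans (cong (y ⟨$⟩ˡ_) xα≡yα) (inverseˡ y)

∈⇒∈G : (G : PermGroup n) {g : Permutation′ n} → g ∈ elems G → g ∈G G
∈⇒∈G G = Any.map λ { refl _ → refl }

∈G-resp-≈ : (G : PermGroup n) (g h : Permutation′ n) → g ≈ₚ h → g ∈G G → h ∈G G
∈G-resp-≈ G g h g≈h = Any.map λ k≈g α → trans (k≈g α) (g≈h α)

∈G-∘ : (G : PermGroup n) (g h : Permutation′ n) → g ∈G G → h ∈G G → (g ∘ₚ h) ∈G G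
∈G-∘ G g h g∈G h∈G with find g∈G | find h∈G
... | g′ , g′∈G , g′≈g | h′ , h′∈G , h′≈h =
  ∈G-resp-≈ G (g′ ∘ₚ h′) (g ∘ₚ h) (λ α → trans (h′≈h (g′ ⟨$⟩ʳ α)) (cong (h ⟨$⟩ʳ_) (g′≈g α)))
    (closed∘ G g′∈G h′∈G)

trivial : ∀ n → PermGroup n
trivial n = record
  { elems    = P.id ∷ []
  ; distinct = All.[] ∷ []
  ; hasId    = here λ _ → refl
  ; closed∘  = λ { (here refl) (here refl) → here λ _ → refl }
  ; closed⁻¹ = λ { (here refl) → here λ _ → refl }
  }

∈-map-elim : {P : Pred B 0ℓ} (f : A → B) (xs : List A) →
  (∀ {x} → x ∈ xs → P (f x)) → ∀ {y} → y ∈ map f xs → P y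
∈-map-elim f xs P[f] y∈ with ∈-map⁻ f y∈
... | x , x∈xs , refl = P[f] x∈xs

module _ {I X : Set} (e : Fin n ↔ X) (π : I → X ↔ X) (π-injective : ∀ i j → π i ≈ π j → i ≡ j)
  where

  conj-distinct : ∀ is → Unique is → AllPairs (λ g h → ¬ (g ≈ₚ h)) (map (conj e ∘ π) is)
  conj-distinct _ is! = AllPairs.map⁺
    (AllPairs.map (λ {i} {j} i≢j eq → i≢j (π-injective i j (conj-injective e {π i} {π j} eq))) is!)

  module _ {is : List I} (complete : ∀ i → i ∈ is) where

    ≈⇒conj∈ : (p : X ↔ X) → ∃[ i ] (π i ≈ p) → Any (_≈ₚ conj e p) (map (conj e ∘ π) is)
    ≈⇒conj∈ p (i , πi≈p) = lose (∈-map⁺ (conj e ∘ π) (complete i)) (conj-cong e {π i} {p} πi≈p)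

    -- `π` lists bijections of a convenient set `X`, and `e` carries them to `Fin n`. Closure only
    -- asks for an index up to pointwise equality. The order in `π j ↔-∘ π i` is reversed because
    -- `_↔-∘_` composes from right to left, `_∘ₚ_` from left to right.
    permGroup : Unique is → ∃[ i ] (π i ≈ ↔-id X) → (∀ i j → ∃[ k ] (π k ≈ π j ↔-∘ π i)) →
      (∀ i → ∃[ k ] (π k ≈ ↔-sym (π i))) → PermGroup n
    permGroup is! hasIdentity hasProducts hasInverses = record
      { elems    = map (conj e ∘ π) is
      ; distinct = conj-distinct is is!
      ; hasId    = Any.map (λ eq α → trans (eq α) (strictlyInverseʳ e α)) (≈⇒conj∈ (↔-id X) hasIdentity)
      ; closed∘  = closed-∘
      ; closed⁻¹ = ∈-map-elim {P = λ g → Any (_≈ₚ P.flip g) (map (conj e ∘ π) is)} (conj e ∘ π) is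
                     λ {i} _ → ≈⇒conj∈ (↔-sym (π i)) (hasInverses i)
      }
      where
      closed-∘ : ∀ {g h} → g ∈ map (conj e ∘ π) is → h ∈ map (conj e ∘ π) is →
        Any (_≈ₚ (g ∘ₚ h)) (map (conj e ∘ π) is)
      closed-∘ g∈ h∈ with ∈-map⁻ (conj e ∘ π) g∈ | ∈-map⁻ (conj e ∘ π) h∈
      ... | i , _ , refl | j , _ , refl =
        Any.map (λ eq α → trans (eq α) (conj-∘ e (π i) (π j) α)) (≈⇒conj∈ (π j ↔-∘ π i) (hasProducts i j))

-- The clique-coclique bound

-- A clique of the derangement graph, where two elements are adjacent when they agree at no point.
-- Its cocliques are the intersecting sets.
Clique : PermGroup n → List (Permutation′ n) → Set
Clique G C =
  (∀ {x} → x ∈ C → x ∈G G)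
  × AllPairs (λ x y → ¬ (x ≈ₚ y)) C
  × (∀ {x y} → x ∈ C → y ∈ C → Agree x y → x ≈ₚ y)

distinct⇒lookup-injective : {xs : List (Permutation′ n)} → AllPairs (λ x y → ¬ (x ≈ₚ y)) xs →
  ∀ i j → List.lookup xs i ≈ₚ List.lookup xs j → i ≡ j
distinct⇒lookup-injective (_ ∷ _) zero zero _ = refl
distinct⇒lookup-injective (x∉xs ∷ _) zero (suc j) x≈y =
  contradiction x≈y (All.lookup x∉xs (∈-lookup j))
distinct⇒lookup-injective (x∉xs ∷ _) (suc i) zero x≈y =
  contradiction (λ α → sym (x≈y α)) (All.lookup x∉xs (∈-lookup i))
distinct⇒lookup-injective (_ ∷ xs!) (suc i) (suc j) x≈y = cong suc (distinct⇒lookup-injective xs! i j x≈y)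

module _ {G : PermGroup n} {S C : List (Permutation′ n)} where

  -- The products x c with x in S and c in C are distinct: if x c = y d and x α = y α,
  -- then c and d agree at x α.
  clique-coclique : IntersectingSet G S → Clique G C → length S * length C ≤ length (elems G)
  clique-coclique (S⊆G , S! , S-int) (C⊆G , C! , C-clique) = injective⇒≤ index-injective
    where
    product : Fin (length S) → Fin (length C) → Permutation′ n
    product i j = List.lookup S i ∘ₚ List.lookup C j

    product∈G : ∀ i j → product i j ∈G G
    product∈G i j = ∈G-∘ G (List.lookup S i) (List.lookup C j) (S⊆G (∈-lookup i)) (C⊆G (∈-lookup j))

    split : Fin (length S * length C) → Fin (length S) × Fin (length C)
    split = remQuot (length C)

    index : Fin (length S * length C) → Fin (length (elems G))
    index = Any.index ∘ uncurry product∈G ∘ split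

    index-correct : (g : Permutation′ n) (g∈G : g ∈G G) → List.lookup (elems G) (Any.index g∈G) ≈ₚ g
    index-correct _ = Any.lookup-index

    product-injective : ∀ i j i′ j′ → product i j ≈ₚ product i′ j′ → i ≡ i′ × j ≡ j′
    product-injective i j i′ j′ eq
      with Intersect⇒Agree (List.lookup S i) (List.lookup S i′) (S-int (∈-lookup i) (∈-lookup i′))
    ... | α , xα≡yα with distinct⇒lookup-injective C! j j′ (C-clique (∈-lookup j) (∈-lookup j′)
                           (_ , trans (eq α) (cong (List.lookup C j′ ⟨$⟩ʳ_) (sym xα≡yα))))
    ... | refl = distinct⇒lookup-injective S! i i′ (λ β → cancelʳ (eq β)) , refl
      where
      cancelʳ : ∀ {β γ} → List.lookup C j ⟨$⟩ʳ β ≡ List.lookup C j ⟨$⟩ʳ γ → β ≡ γ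
      cancelʳ e = trans (sym (inverseˡ (List.lookup C j)))
                        (trans (cong (List.lookup C j ⟨$⟩ˡ_) e) (inverseˡ (List.lookup C j)))

    index-injective : ∀ {x y} → index x ≡ index y → x ≡ y
    index-injective {x} {y} eq = begin
      x                          ≡⟨ combine-remQuot {length S} (length C) x ⟨
      uncurry combine (split x)  ≡⟨ uncurry (cong₂ combine) (product-injective _ _ _ _ products≈) ⟩
      uncurry combine (split y)  ≡⟨ combine-remQuot {length S} (length C) y ⟩
      y                          ∎
      where
      open ≡-Reasoning

      products≈ : uncurry product (split x) ≈ₚ uncurry product (split y)
      products≈ α = begin
        uncurry product (split x) ⟨$⟩ʳ α
          ≡⟨ index-correct (uncurry product (split x)) (uncurry product∈G (split x)) α ⟨
        List.lookup (elems G) (index x) ⟨$⟩ʳ α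
          ≡⟨ cong (λ l → List.lookup (elems G) l ⟨$⟩ʳ α) eq ⟩
        List.lookup (elems G) (index y) ⟨$⟩ʳ α
          ≡⟨ index-correct (uncurry product (split y)) (uncurry product∈G (split y)) α ⟩
        uncurry product (split y) ⟨$⟩ʳ α ∎

-- The parameters s and t are |G_ω| and the size of a maximum intersecting set.
record CliqueCocliqueTight (G : PermGroup n) (s t : ℕ) : Set where
  field
    transitive        : Transitive G
    stabSize≡         : ∀ ω → stabSize G ω ≡ s
    {coclique clique} : List (Permutation′ n)
    isCoclique        : IntersectingSet G coclique
    isClique          : Clique G clique
    length-coclique   : length coclique ≡ t
    tight             : t * length clique ≡ length (elems G)

module _ {G : PermGroup n} (T : CliqueCocliqueTight G s t) where
  open CliqueCocliqueTight T

  private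
    clique-nonempty : ∀ l → t * l ≡ length (elems G) → NonZero l
    clique-nonempty (suc _) _ = _
    clique-nonempty zero t*0≡|G| = contradiction (hasId G) (empty t (elems G) t*0≡|G|)
      where
      empty : ∀ t (xs : List (Permutation′ n)) → t * 0 ≡ length xs → ¬ Any (_≈ₚ P.id) xs
      -- `t * 0` is stuck for a variable `t`, but `suc t * 0` reduces to `t * 0`, hence the
      -- recursion.
      empty (suc t) xs       eq = empty t xs eq
      empty zero    []       eq ()

  -- For an intersecting `R` the clique-coclique bound and tightness give |R| |C| ≤ |G| = t |C|. The
  -- factor |C| cancels: it is nonzero, since otherwise |G| = 0, whereas G contains the identity.
  coclique-maximum : MaximumIntersectingSet G coclique
  coclique-maximum = isCoclique , λ R R-int →
    *-cancelʳ-≤ _ _ (length clique) {{clique-nonempty _ tight}}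
      (≤-trans (clique-coclique {G = G} {S = R} R-int isClique)
        (≤-reflexive (trans (sym tight) (cong (_* length clique) (sym length-coclique)))))

  rho>√degree : n * (s * s) < t * t → RhoGtSqrtDegree G
  rho>√degree bound = coclique , coclique-maximum , λ ω →
    subst₂ (λ u v → n * (u * u) < v * v) (sym (stabSize≡ ω)) (sym length-coclique) bound

-- Direct products in their product action

infixr 7 _⊗_
_⊗_ : Permutation′ m → Permutation′ n → Permutation′ (m * n)
g ⊗ h = conj *↔× (g ×-↔ h)

⊗-combine : (g : Permutation′ m) (h : Permutation′ n) → ∀ i j →
  (g ⊗ h) ⟨$⟩ʳ combine i j ≡ combine (g ⟨$⟩ʳ i) (h ⟨$⟩ʳ j)
⊗-combine g h i j = conj-from *↔× (g ×-↔ h) (i , j)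

⊗-cong : {g g′ : Permutation′ m} {h h′ : Permutation′ n} → g ≈ₚ g′ → h ≈ₚ h′ → (g ⊗ h) ≈ₚ (g′ ⊗ h′)
⊗-cong {g = g} {g′} {h} {h′} g≈g′ h≈h′ =
  conj-cong *↔× {p = g ×-↔ h} {q = g′ ×-↔ h′} λ (i , j) → cong₂ _,_ (g≈g′ i) (h≈h′ j)

⊗-∘ : (g g′ : Permutation′ m) (h h′ : Permutation′ n) → (g ∘ₚ g′) ⊗ (h ∘ₚ h′) ≈ (g ⊗ h) ∘ₚ (g′ ⊗ h′)
⊗-∘ g g′ h h′ = conj-∘ *↔× (g ×-↔ h) (g′ ×-↔ h′)

⊗-agree⁻ : (g g′ : Permutation′ m) (h h′ : Permutation′ n) → ∀ i j →
  (g ⊗ h) ⟨$⟩ʳ combine i j ≡ (g′ ⊗ h′) ⟨$⟩ʳ combine i j → g ⟨$⟩ʳ i ≡ g′ ⟨$⟩ʳ i × h ⟨$⟩ʳ j ≡ h′ ⟨$⟩ʳ j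
⊗-agree⁻ g g′ h h′ i j eq =
  combine-injective _ _ _ _ (trans (sym (⊗-combine g h i j)) (trans eq (⊗-combine g′ h′ i j)))

⊗-agree⁺ : (g g′ : Permutation′ m) (h h′ : Permutation′ n) → ∀ i j →
  g ⟨$⟩ʳ i ≡ g′ ⟨$⟩ʳ i → h ⟨$⟩ʳ j ≡ h′ ⟨$⟩ʳ j → (g ⊗ h) ⟨$⟩ʳ combine i j ≡ (g′ ⊗ h′) ⟨$⟩ʳ combine i j
⊗-agree⁺ g g′ h h′ i j gi≡g′i hj≡h′j =
  trans (⊗-combine g h i j) (trans (cong₂ combine gi≡g′i hj≡h′j) (sym (⊗-combine g′ h′ i j)))

*-interchange : ∀ a b c d → a * b * (c * d) ≡ a * c * (b * d)
*-interchange = solve-∀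

length-cartesianProductWith : (f : A → B → C) → ∀ xs ys →
  length (cartesianProductWith f xs ys) ≡ length xs * length ys
length-cartesianProductWith f []       ys = refl
length-cartesianProductWith f (x ∷ xs) ys = trans (length-++ (map (f x) ys))
  (cong₂ _+_ (length-map (f x) ys) (length-cartesianProductWith f xs ys))

-- This counts point stabilizers: the stabilizer of a pair (i , j) in a direct product is the
-- product of the stabilizers of i and j.
length-filter-cartesianProductWith : {P : Pred A 0ℓ} {Q : Pred B 0ℓ} {R : Pred C 0ℓ}
  (P? : Decidable P) (Q? : Decidable Q) (R? : Decidable R) (f : A → B → C) →
  (∀ {x y} → R (f x y) → P x × Q y) → (∀ {x y} → P x → Q y → R (f x y)) → ∀ xs ys →
  length (filter R? (cartesianProductWith f xs ys)) ≡ length (filter P? xs) * length (filter Q? ys)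
length-filter-cartesianProductWith P? Q? R? f R⇒ ⇒R [] ys = refl
length-filter-cartesianProductWith {P = P} P? Q? R? f R⇒ ⇒R (x ∷ xs) ys = begin
  length (filter R? (map (f x) ys ++ cartesianProductWith f xs ys))
    ≡⟨ cong length (filter-++ R? (map (f x) ys) _) ⟩
  length (filter R? (map (f x) ys) ++ filter R? (cartesianProductWith f xs ys))
    ≡⟨ length-++ (filter R? (map (f x) ys)) ⟩
  length (filter R? (map (f x) ys)) + length (filter R? (cartesianProductWith f xs ys))
    ≡⟨ cong (_ +_) (length-filter-cartesianProductWith P? Q? R? f R⇒ ⇒R xs ys) ⟩
  length (filter R? (map (f x) ys)) + length (filter P? xs) * length (filter Q? ys)
    ≡⟨ row (P? x) ⟩
  length (filter P? (x ∷ xs)) * length (filter Q? ys) ∎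
  where
  open ≡-Reasoning

  accepted : P x → ∀ ys → length (filter R? (map (f x) ys)) ≡ length (filter Q? ys)
  accepted Px [] = refl
  accepted Px (y ∷ ys) with Q? y
  ... | yes Qy = trans (cong length (filter-accept R? (⇒R Px Qy))) (cong suc (accepted Px ys))
  ... | no ¬Qy = trans (cong length (filter-reject R? (¬Qy ∘ proj₂ ∘ R⇒))) (accepted Px ys)

  rejected : ¬ P x → ∀ ys → filter R? (map (f x) ys) ≡ []
  rejected ¬Px [] = refl
  rejected ¬Px (y ∷ ys) = trans (filter-reject R? (¬Px ∘ proj₁ ∘ R⇒)) (rejected ¬Px ys)

  row : Dec (P x) →
    length (filter R? (map (f x) ys)) + length (filter P? xs) * length (filter Q? ys)
      ≡ length (filter P? (x ∷ xs)) * length (filter Q? ys)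
  row (yes Px) rewrite filter-accept P? {xs = xs} Px | accepted Px ys = refl
  row (no ¬Px) rewrite filter-reject P? {xs = xs} ¬Px | rejected ¬Px ys = refl

-- Without a base point in each factor, _⊗_ need not be injective: Fin (m * 0) has only one permutation.
module _ (ω₁ : Fin m) (ω₂ : Fin n) where

  ⊗-injective : {g g′ : Permutation′ m} {h h′ : Permutation′ n} →
    (g ⊗ h) ≈ₚ (g′ ⊗ h′) → g ≈ₚ g′ × h ≈ₚ h′
  ⊗-injective {g} {g′} {h} {h′} eq =
    (λ i → proj₁ (⊗-agree⁻ g g′ h h′ i ω₂ (eq _))) , (λ j → proj₂ (⊗-agree⁻ g g′ h h′ ω₁ j (eq _)))

  ⊗-distinct : {xs : List (Permutation′ m)} {ys : List (Permutation′ n)} →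
    AllPairs (λ g h → ¬ (g ≈ₚ h)) xs → AllPairs (λ g h → ¬ (g ≈ₚ h)) ys →
    AllPairs (λ g h → ¬ (g ≈ₚ h)) (cartesianProductWith _⊗_ xs ys)
  ⊗-distinct = UniqueSetoid.cartesianProductWith⁺ (≈-setoid m) (≈-setoid n) (≈-setoid (m * n)) _⊗_
    λ {g} {g′} {h} {h′} → ⊗-injective {g} {g′} {h} {h′}

  module _ (G : PermGroup m) (H : PermGroup n) where

    private
      pairs : (g : Permutation′ m) (h : Permutation′ n) → Any (_≈ₚ g) (elems G) → Any (_≈ₚ h) (elems H) →
        Any (_≈ₚ (g ⊗ h)) (cartesianProductWith _⊗_ (elems G) (elems H))
      pairs g h = Any.cartesianProductWith⁺ _⊗_ λ {g′} {h′} → ⊗-cong {g = g′} {g} {h′} {h}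

    product : PermGroup (m * n)
    product = record
      { elems    = cartesianProductWith _⊗_ (elems G) (elems H)
      ; distinct = ⊗-distinct (distinct G) (distinct H)
      ; hasId    = Any.map (λ eq α → trans (eq α) (strictlyInverseʳ (*↔× {m} {n}) α))
                     (pairs P.id P.id (hasId G) (hasId H))
      ; closed∘  = closed-∘
      ; closed⁻¹ = closed-⁻¹
      }
      where
      closed-∘ : ∀ {g h} → g ∈ cartesianProductWith _⊗_ (elems G) (elems H) →
        h ∈ cartesianProductWith _⊗_ (elems G) (elems H) →
        Any (_≈ₚ (g ∘ₚ h)) (cartesianProductWith _⊗_ (elems G) (elems H))
      closed-∘ g∈ h∈ with ∈-cartesianProductWith⁻ _⊗_ (elems G) (elems H) g∈
                        | ∈-cartesianProductWith⁻ _⊗_ (elems G) (elems H) h∈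
      ... | g , h , g∈G , h∈H , refl | g′ , h′ , g′∈G , h′∈H , refl =
        Any.map (λ eq α → trans (eq α) (⊗-∘ g g′ h h′ α))
          (pairs (g ∘ₚ g′) (h ∘ₚ h′) (closed∘ G g∈G g′∈G) (closed∘ H h∈H h′∈H))

      closed-⁻¹ : ∀ {g} → g ∈ cartesianProductWith _⊗_ (elems G) (elems H) →
        Any (_≈ₚ P.flip g) (cartesianProductWith _⊗_ (elems G) (elems H))
      closed-⁻¹ g∈ with ∈-cartesianProductWith⁻ _⊗_ (elems G) (elems H) g∈
      ... | g , h , g∈G , h∈H , refl = pairs (P.flip g) (P.flip h) (closed⁻¹ G g∈G) (closed⁻¹ H h∈H)

    ⊗-∈G : (g : Permutation′ m) (h : Permutation′ n) → g ∈G G → h ∈G H → (g ⊗ h) ∈G product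
    ⊗-∈G = pairs

    -- Two product elements agree at (i , j) exactly when their components agree at i and at j. So
    -- products of cocliques are cocliques and products of cliques are cliques. Maximality is
    -- carried to the product by the equality t |C| = |G|, which multiplies.
    product-tight : CliqueCocliqueTight G s t → CliqueCocliqueTight H s′ t′ →
      CliqueCocliqueTight product (s * s′) (t * t′)
    product-tight {s} {t} {s′} {t′} T U = record
      { transitive      = transitive
      ; stabSize≡       = stabSize≡
      ; coclique        = cartesianProductWith _⊗_ T.coclique U.coclique
      ; clique          = cartesianProductWith _⊗_ T.clique U.clique
      ; isCoclique      = ⊆G (proj₁ T.isCoclique) (proj₁ U.isCoclique)
                        , ⊗-distinct (proj₁ (proj₂ T.isCoclique)) (proj₁ (proj₂ U.isCoclique))
                        , intersecting
      ; isClique        = ⊆G (proj₁ T.isClique) (proj₁ U.isClique)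
                        , ⊗-distinct (proj₁ (proj₂ T.isClique)) (proj₁ (proj₂ U.isClique))
                        , agree⇒≈
      ; length-coclique = trans (length-cartesianProductWith _⊗_ T.coclique U.coclique)
                            (cong₂ _*_ T.length-coclique U.length-coclique)
      ; tight           = tight
      }
      where
      module T = CliqueCocliqueTight T
      module U = CliqueCocliqueTight U

      ⊆G : {xs : List (Permutation′ m)} {ys : List (Permutation′ n)} →
        (∀ {x} → x ∈ xs → x ∈G G) → (∀ {y} → y ∈ ys → y ∈G H) →
        ∀ {z} → z ∈ cartesianProductWith _⊗_ xs ys → z ∈G product
      ⊆G {xs} {ys} xs⊆G ys⊆H z∈ with ∈-cartesianProductWith⁻ _⊗_ xs ys z∈
      ... | x , y , x∈xs , y∈ys , refl = ⊗-∈G x y (xs⊆G x∈xs) (ys⊆H y∈ys)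

      transitive : Transitive product
      transitive α β with combine-surjective {m} {n} α | combine-surjective {m} {n} β
      ... | i , j , refl | i′ , j′ , refl with T.transitive i i′ | U.transitive j j′
      ... | g , g∈G , gi≡i′ | h , h∈H , hj≡j′ =
        g ⊗ h , ⊗-∈G g h g∈G h∈H , trans (⊗-combine g h i j) (cong₂ combine gi≡i′ hj≡j′)

      stabSize≡ : ∀ ω → stabSize product ω ≡ s * s′
      stabSize≡ ω with combine-surjective {m} {n} ω
      ... | i , j , refl = trans
        (length-filter-cartesianProductWith (λ g → g ⟨$⟩ʳ i ≟ i) (λ h → h ⟨$⟩ʳ j ≟ j) _ _⊗_
          (λ {g} {h} eq → combine-injective _ _ _ _ (trans (sym (⊗-combine g h i j)) eq))
          (λ {g} {h} gi≡i hj≡j → trans (⊗-combine g h i j) (cong₂ combine gi≡i hj≡j))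
          (elems G) (elems H))
        (cong₂ _*_ (T.stabSize≡ i) (U.stabSize≡ j))

      intersecting : ∀ {x y} → x ∈ cartesianProductWith _⊗_ T.coclique U.coclique →
        y ∈ cartesianProductWith _⊗_ T.coclique U.coclique → Intersect x y
      intersecting x∈ y∈ with ∈-cartesianProductWith⁻ _⊗_ T.coclique U.coclique x∈
                            | ∈-cartesianProductWith⁻ _⊗_ T.coclique U.coclique y∈
      ... | g , h , g∈S , h∈S , refl | g′ , h′ , g′∈S , h′∈S , refl
        with Intersect⇒Agree g g′ (proj₂ (proj₂ T.isCoclique) g∈S g′∈S)
           | Intersect⇒Agree h h′ (proj₂ (proj₂ U.isCoclique) h∈S h′∈S)
      ... | i , gi≡g′i | j , hj≡h′j =
        Agree⇒Intersect (g ⊗ h) (g′ ⊗ h′) (combine i j , ⊗-agree⁺ g g′ h h′ i j gi≡g′i hj≡h′j)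

      agree⇒≈ : ∀ {x y} → x ∈ cartesianProductWith _⊗_ T.clique U.clique →
        y ∈ cartesianProductWith _⊗_ T.clique U.clique → Agree x y → x ≈ₚ y
      agree⇒≈ x∈ y∈ (α , xα≡yα) with ∈-cartesianProductWith⁻ _⊗_ T.clique U.clique x∈
                                   | ∈-cartesianProductWith⁻ _⊗_ T.clique U.clique y∈
                                   | combine-surjective {m} {n} α
      ... | g , h , g∈C , h∈C , refl | g′ , h′ , g′∈C , h′∈C , refl | i , j , refl
        with ⊗-agree⁻ g g′ h h′ i j xα≡yα
      ... | gi≡g′i , hj≡h′j = ⊗-cong {g = g} {g′} {h} {h′}
        (proj₂ (proj₂ T.isClique) g∈C g′∈C (i , gi≡g′i)) (proj₂ (proj₂ U.isClique) h∈C h′∈C (j , hj≡h′j))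

      tight : t * t′ * length (cartesianProductWith _⊗_ T.clique U.clique)
                ≡ length (cartesianProductWith _⊗_ (elems G) (elems H))
      tight = begin
        t * t′ * length (cartesianProductWith _⊗_ T.clique U.clique)
          ≡⟨ cong (t * t′ *_) (length-cartesianProductWith _⊗_ T.clique U.clique) ⟩
        t * t′ * (length T.clique * length U.clique)
          ≡⟨ *-interchange t t′ (length T.clique) (length U.clique) ⟩
        t * length T.clique * (t′ * length U.clique)
          ≡⟨ cong₂ _*_ T.tight U.tight ⟩
        length (elems G) * length (elems H)
          ≡⟨ length-cartesianProductWith _⊗_ (elems G) (elems H) ⟨
        length (cartesianProductWith _⊗_ (elems G) (elems H)) ∎
        where open ≡-Reasoning

-- Powers

trivial-tight : CliqueCocliqueTight (trivial 1) 1 1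
trivial-tight = record
  { transitive      = λ { 0F 0F → P.id , here (λ _ → refl) , refl }
  ; stabSize≡       = λ { 0F → refl }
  ; coclique        = P.id ∷ []
  ; clique          = P.id ∷ []
  ; isCoclique      = (λ { (here refl) → here λ _ → refl }) , All.[] ∷ []
                    , λ { (here refl) (here refl) → 0F , refl }
  ; isClique        = (λ { (here refl) → here λ _ → refl }) , All.[] ∷ []
                    , λ { (here refl) (here refl) _ _ → refl }
  ; length-coclique = refl
  ; tight           = refl
  }

×↔Vec : (A × Vec A k) ↔ Vec A (suc k)
×↔Vec = mk↔ₛ′ (uncurry _∷_) uncons (λ { (_ ∷ _) → refl }) (λ _ → refl)

vectors : ∀ k → Fin (m ^ k) ↔ Vec (Fin m) k
vectors zero = mk↔ₛ′ (λ _ → []) (λ _ → 0F) (λ { [] → refl }) (λ { 0F → refl ; (suc ()) })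
vectors {m} (suc k) = ×↔Vec ↔-∘ ((↔-id (Fin m) ×-↔ vectors k) ↔-∘ *↔×)

tuple : (Fin k → Permutation′ m) → Permutation′ (m ^ k)
tuple {zero}  hs = P.id
tuple {suc k} hs = hs 0F ⊗ tuple (hs ∘ suc)

lookup-tuple : (hs : Fin k → Permutation′ m) → ∀ α θ →
  lookup (to (vectors k) (tuple hs ⟨$⟩ʳ α)) θ ≡ hs θ ⟨$⟩ʳ lookup (to (vectors k) α) θ
lookup-tuple {suc k} {m} hs α θ = trans
  -- `to-conj` removes the numbering of pairs, so that the first coordinate splits off and the
  -- induction runs over the others.
  (cong (λ (i , β) → lookup (i ∷ to (vectors k) β) θ) (to-conj (*↔× {m} {m ^ k}) (hs 0F ×-↔ tuple (hs ∘ suc)) α))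
  (componentwise θ)
  where
  αᵗ : Fin m × Fin (m ^ k)
  αᵗ = to (hs 0F ×-↔ tuple (hs ∘ suc)) (to (*↔× {m}) α)

  componentwise : ∀ θ → lookup (proj₁ αᵗ ∷ to (vectors k) (proj₂ αᵗ)) θ
    ≡ hs θ ⟨$⟩ʳ lookup (to (vectors (suc k)) α) θ
  componentwise 0F      = refl
  componentwise (suc θ) = lookup-tuple (hs ∘ suc) (proj₂ (to (*↔× {m}) α)) θ

module _ (ω : Fin m) (H : PermGroup m) where

  origin : ∀ k → Fin (m ^ k)
  origin zero    = 0F
  origin (suc k) = combine ω (origin k)

  power : ∀ k → PermGroup (m ^ k)
  power zero    = trivial 1
  power (suc k) = product ω (origin k) H (power k)

  power-tight : CliqueCocliqueTight H s t → ∀ k → CliqueCocliqueTight (power k) (s ^ k) (t ^ k)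
  power-tight T zero    = trivial-tight
  power-tight T (suc k) = product-tight ω (origin k) H (power k) T (power-tight T k)

  tuple∈power : (hs : Fin k → Permutation′ m) → (∀ θ → hs θ ∈G H) → tuple hs ∈G power k
  tuple∈power {zero}  hs hs∈H = here λ _ → refl
  tuple∈power {suc k} hs hs∈H =
    ⊗-∈G ω (origin k) H (power k) (hs 0F) (tuple (hs ∘ suc)) (hs∈H 0F) (tuple∈power (hs ∘ suc) (hs∈H ∘ suc))

  -- Equality is strict here, not just pointwise, because the list of a power consists of the very
  -- terms `h ⊗ g` from which `tuple` is built.
  power⇒tuple : ∀ k {g} → g ∈ elems (power k) →
    Σ (Fin k → Permutation′ m) λ hs → (∀ θ → hs θ ∈ elems H) × g ≡ tuple hs
  power⇒tuple zero    (here refl) = (λ ()) , (λ ()) , refl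
  power⇒tuple (suc k) g∈ with ∈-cartesianProductWith⁻ _⊗_ (elems H) (elems (power k)) g∈
  ... | h , g′ , h∈H , g′∈ , refl with power⇒tuple k g′∈
  ... | hs , hs∈H , refl = h Vector.∷ hs , (λ { 0F → h∈H ; (suc θ) → hs∈H θ }) , refl

  -- Over a trivial top group the wreath product is its base group, whose elements are the tuples.
  -- Membership is up to pointwise equality, so `σ` need not be `P.id` itself; `acts` therefore
  -- works from `P.id ≈ₚ σ`.
  power≅wreath : ∀ k → PermEquivWreath (power k) H (trivial k)
  power≅wreath k = vectors k , (λ {g} → forward {g}) , backward
    where
    open ≡-Reasoning

    acts : (hs : Fin k → Permutation′ m) (σ : Permutation′ k) (g : Permutation′ (m ^ k)) →
      P.id ≈ₚ σ → tuple hs ≈ₚ g → WreathActs hs σ (to (vectors k) ∘ (g ⟨$⟩ʳ_) ∘ from (vectors k))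
    acts hs σ g id≈σ hs≈g v θ = begin
      lookup (to (vectors k) (g ⟨$⟩ʳ from (vectors k) v)) (σ ⟨$⟩ʳ θ)
        ≡⟨ cong₂ (λ α → lookup (to (vectors k) α)) (sym (hs≈g _)) (sym (id≈σ θ)) ⟩
      lookup (to (vectors k) (tuple hs ⟨$⟩ʳ from (vectors k) v)) θ
        ≡⟨ lookup-tuple hs (from (vectors k) v) θ ⟩
      hs θ ⟨$⟩ʳ lookup (to (vectors k) (from (vectors k) v)) θ
        ≡⟨ cong (λ u → hs θ ⟨$⟩ʳ lookup u θ) (strictlyInverseˡ (vectors k) v) ⟩
      hs θ ⟨$⟩ʳ lookup v θ ∎

    forward : ∀ {g} → g ∈G power k → ∃[ hs ] ((∀ θ → hs θ ∈G H) × ∃[ σ ] (σ ∈G trivial k ×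
      WreathActs hs σ (to (vectors k) ∘ (g ⟨$⟩ʳ_) ∘ from (vectors k))))
    forward {g} g∈ with find g∈
    ... | g′ , g′∈ , g′≈g with power⇒tuple k g′∈
    ... | hs , hs∈H , refl =
      hs , (λ θ → ∈⇒∈G H (hs∈H θ)) , P.id , here (λ _ → refl) , acts hs P.id g (λ _ → refl) g′≈g

    backward : ∀ hs σ → (∀ θ → hs θ ∈G H) → σ ∈G trivial k → ∃[ g ] (g ∈G power k ×
      WreathActs hs σ (to (vectors k) ∘ (g ⟨$⟩ʳ_) ∘ from (vectors k)))
    backward hs σ hs∈H (here id≈σ) =
      tuple hs , tuple∈power hs hs∈H , acts hs σ (tuple hs) id≈σ (λ _ → refl)

-- Inequalities between powers

^-distribʳ-* : ∀ a b k → (a * b) ^ k ≡ a ^ k * b ^ k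
^-distribʳ-* a b zero    = refl
^-distribʳ-* a b (suc k) = trans (cong (a * b *_) (^-distribʳ-* a b k)) (*-interchange a b (a ^ k) (b ^ k))

-- The k-th power of the given inequality, with the factors regrouped. For k = 0 both sides would be
-- 1, hence `NonZero k`.
power-bound : ∀ m s t k .{{_ : NonZero k}} → m * (s * s) < t * t → m ^ k * (s ^ k * s ^ k) < t ^ k * t ^ k
power-bound m s t k bound = subst₂ _<_
  (trans (^-distribʳ-* m (s * s) k) (cong (m ^ k *_) (^-distribʳ-* s s k)))
  (^-distribʳ-* t t k)
  (^-monoˡ-< k bound)

n<m^n : ∀ m n → 1 < m → n < m ^ n
n<m^n m zero    1<m = z<s
n<m^n m (suc n) 1<m = ≤-<-trans (n<m^n m n 1<m) (^-monoʳ-< m 1<m {n} ≤-refl)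

-- The group H = 3³:A₄ on 18 planes

-- (i , s , c) stands for the plane x_{i+1} = ± x_{i+2} + c of 𝔽₃³, with indices modulo 3 and
-- with sign + if s = 0 and - if s = 1.
Plane : Set
Plane = Fin 3 × Fin 2 × Fin 3

base : Plane
base = 0F , 0F , 0F

planes : Fin 18 ↔ Plane
planes = (↔-id (Fin 3) ×-↔ *↔× {2} {3}) ↔-∘ *↔× {3} {6}

_≟ᴾ_ : (x y : Plane) → Dec (x ≡ y)
_≟ᴾ_ = ≡-dec _≟_ (≡-dec _≟_ _≟_)

allPlanes? : {P : Pred Plane 0ℓ} → Decidable P → Dec (∀ x → P x)
allPlanes? P? = map′ (λ f (i , s , c) → f i s c) (λ f i s c → f (i , s , c))
  (all? λ i → all? λ s → all? λ c → P? (i , s , c))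

anyPlane? : {P : Pred Plane 0ℓ} → Decidable P → Dec (∃ P)
anyPlane? P? = map′ (λ (i , s , c , p) → (i , s , c) , p) (λ ((i , s , c) , p) → i , s , c , p)
  (any? λ i → any? λ s → any? λ c → P? (i , s , c))

infix 4 _≈?_
_≈?_ : (p q : Plane ↔ Plane) → Dec (p ≈ q)
p ≈? q = allPlanes? λ x → to p x ≟ᴾ to q x

next neg : Fin 3 → Fin 3
next 0F = 1F
next 1F = 2F
next 2F = 0F
neg 0F = 0F
neg 1F = 2F
neg 2F = 1F

_⊕_ : Fin 3 → Fin 3 → Fin 3
0F ⊕ b = b
1F ⊕ b = next b
2F ⊕ b = next (next b)

opp : Fin 2 → Fin 2
opp 0F = 1F
opp 1F = 0F

-- ρ moves the i-th coordinate to position i + 1, σ = diag(1 , -1 , -1) and τ adds 1 to x₀.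
data Generator : Set where
  ρ σ τ : Generator

move : Generator → Plane → Plane
move ρ (i  , s  , c) = next i , s , c
move σ (0F , s  , c) = 0F , s , neg c
move σ (1F , s  , c) = 1F , opp s , neg c
move σ (2F , s  , c) = 2F , opp s , c
move τ (0F , s  , c) = 0F , s , c
move τ (1F , 0F , c) = 1F , 0F , next (next c)
move τ (1F , 1F , c) = 1F , 1F , next c
move τ (2F , s  , c) = 2F , s , next c

unmove : Generator → Plane → Plane
unmove ρ = move ρ ∘ move ρ
unmove σ = move σ
unmove τ = move τ ∘ move τ

allGenerators? : {P : Pred Generator 0ℓ} → Decidable P → Dec (∀ g → P g)
allGenerators? P? = map′ (λ { (r , s , t) ρ → r ; (r , s , t) σ → s ; (r , s , t) τ → t })
  (λ f → f ρ , f σ , f τ) (P? ρ ×-dec P? σ ×-dec P? τ)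

-- Words and normal forms in the generators

generator : Generator → Plane ↔ Plane
generator g = mk↔ₛ′ (move g) (unmove g)
  (toWitness {a? = allGenerators? λ g → allPlanes? λ x → move g (unmove g x) ≟ᴾ x} _ g)
  (toWitness {a? = allGenerators? λ g → allPlanes? λ x → unmove g (move g x) ≟ᴾ x} _ g)

-- The leftmost letter acts first.
word : List Generator → Plane ↔ Plane
word = foldr (λ g p → p ↔-∘ generator g) (↔-id Plane)

-- The 3 · 2² · 3³ = 324 indices of the elements of H. The exponent of the coordinate cycle comes
-- first; M is the part where it is 0.
Exponents : Set
Exponents = Fin 3 × Fin 2 × Fin 2 × Fin 3 × Fin 3 × Fin 3

_≟ᴱ_ : (a b : Exponents) → Dec (a ≡ b)
_≟ᴱ_ = ≡-dec _≟_ (≡-dec _≟_ (≡-dec _≟_ (≡-dec _≟_ (≡-dec _≟_ _≟_))))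

allExponents? : {P : Pred Exponents 0ℓ} → Decidable P → Dec (∀ a → P a)
allExponents? P? = map′ (λ f (w , u , v , x , y , z) → f w u v x y z) (λ f w u v x y z → f (w , u , v , x , y , z))
  (all? λ w → all? λ u → all? λ v → all? λ x → all? λ y → all? λ z → P? (w , u , v , x , y , z))

anyExponents? : {P : Pred Exponents 0ℓ} → Decidable P → Dec (∃ P)
anyExponents? P? = map′
  (λ (w , u , v , x , y , z , p) → (w , u , v , x , y , z) , p)
  (λ ((w , u , v , x , y , z) , p) → w , u , v , x , y , z , p)
  (any? λ w → any? λ u → any? λ v → any? λ x → any? λ y → any? λ z → P? (w , u , v , x , y , z))

-- Sign changes, then translations, then ρʷ. The three interspersed letters ρ move σ and τ to the other
-- coordinates, and multiply to ρ³ = 1.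
normalForm : Exponents → List Generator
normalForm (w , u , v , x , y , z) =
  σ ** u ++ ρ ∷ σ ** v ++ τ ** x ++ ρ ∷ τ ** y ++ ρ ∷ τ ** z ++ ρ ** w
  where
  _**_ : Generator → Fin n → List Generator
  g ** e = replicate (toℕ e) g
  infix 8 _**_

element : Exponents → Plane ↔ Plane
element a = word (normalForm a)

-- A translation by t adds t_{i+1} ∓ t_{i+2} to the
-- constant term of a plane (i , s , _), so that the sum over both signs is 2 t_{i+1} = - t_{i+1}.
exponents : (Plane → Plane) → Exponents
-- Sign changes and translations keep the index i of a plane, and ρ³ = 1, so the image of `base` has
-- index w. On planes of index 2 only σᵘ changes the sign; on planes of index 0 only σᵛ does, as it
-- comes after one ρ. After one, two and three letters ρ, τ acts on the original coordinates 2, 1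
-- and 0, which gives the order of the shifts.
exponents f = proj₁ (f base) , sign 2F , sign 0F , shift 1F , shift 0F , shift 2F
  where
  sign : Fin 3 → Fin 2
  sign i = proj₁ (proj₂ (f (i , 0F , 0F)))

  shift : Fin 3 → Fin 3
  shift i = neg (proj₂ (proj₂ (f (i , 0F , 0F))) ⊕ proj₂ (proj₂ (f (i , 1F , 0F))))

-- Facts about the 324 normal forms, decided by evaluation

abstract
  exponents-element : ∀ a → exponents (to (element a)) ≡ a
  exponents-element = toWitness {a? = allExponents? λ a → exponents (to (element a)) ≟ᴱ a} _

  -- Closure is checked against the three generators only, 3 · 324 cases instead of 324². The index
  -- of the product is computed by `exponents`, not searched for.
  element-generator : ∀ g a → let p = generator g ↔-∘ element a in element (exponents (to p)) ≈ p
  element-generator = toWitness {a? = allGenerators? λ g → allExponents? λ a →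
    let p = generator g ↔-∘ element a in element (exponents (to p)) ≈? p} _

  element-⁻¹ : ∀ a → element (exponents (from (element a))) ≈ ↔-sym (element a)
  element-⁻¹ = toWitness {a? = allExponents? λ a →
    element (exponents (from (element a))) ≈? ↔-sym (element a)} _

  element-id : element (exponents (λ x → x)) ≈ ↔-id Plane
  element-id = toWitness {a? = element (exponents (λ x → x)) ≈? ↔-id Plane} _

  element-transitive : ∀ x y → ∃[ a ] (to (element a) x ≡ y)
  element-transitive = toWitness {a? = allPlanes? λ x → allPlanes? λ y →
    anyExponents? λ a → to (element a) x ≟ᴾ y} _

  -- It is enough to treat single elements of M: a pair is later reduced to its quotient, which lies
  -- in M again.
  kernel-fixes-plane : ∀ a → proj₁ a ≡ 0F → ∃[ x ] (to (element a) x ≡ x)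
  kernel-fixes-plane = toWitness {a? = allExponents? λ a →
    proj₁ a ≟ 0F →-dec anyPlane? λ x → to (element a) x ≟ᴾ x} _

  kernel-fixes-coordinates : ∀ a → proj₁ a ≡ 0F → ∀ x → proj₁ (to (element a) x) ≡ proj₁ x
  kernel-fixes-coordinates = toWitness {a? = allExponents? λ a →
    proj₁ a ≟ 0F →-dec allPlanes? λ x → proj₁ (to (element a) x) ≟ proj₁ x} _

-- `exponents` reads a map only at the six planes with constant term 0.
exponents-cong : {f g : Plane → Plane} → f ≗ g → exponents f ≡ exponents g
exponents-cong {f} {g} f≗g
  rewrite f≗g base | f≗g (1F , 0F , 0F) | f≗g (2F , 0F , 0F)
        | f≗g (0F , 1F , 0F) | f≗g (1F , 1F , 0F) | f≗g (2F , 1F , 0F) = refl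

element-injective : ∀ a b → element a ≈ element b → a ≡ b
element-injective a b eq =
  trans (sym (exponents-element a)) (trans (exponents-cong eq) (exponents-element b))

-- The letters are absorbed into the normal form one at a time. With the normal form of b as the
-- word, this gives closure under products.
element-word : ∀ ws a → ∃[ b ] (element b ≈ word ws ↔-∘ element a)
element-word []       a = a , λ _ → refl
element-word (g ∷ ws) a =
  let b , b≈ws∘a′ = element-word ws (exponents (move g ∘ to (element a)))
  in  b , λ x → trans (b≈ws∘a′ x) (cong (to (word ws)) (element-generator g a x))

-- H as a permutation group of degree 18, with its coclique and clique

act : Exponents → Permutation′ 18
act a = conj planes (element a)

signedTranslations : List (Fin 2 × Fin 2 × Fin 3 × Fin 3 × Fin 3)
signedTranslations = cartesianProduct (allFin 2) (cartesianProduct (allFin 2)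
  (cartesianProduct (allFin 3) (cartesianProduct (allFin 3) (allFin 3))))

withCycles : List (Fin 3) → List Exponents
withCycles ws = cartesianProduct ws signedTranslations

withCycles-unique : ∀ {ws} → Unique ws → Unique (withCycles ws)
withCycles-unique ws! = Unique.cartesianProduct⁺ ws! (Unique.cartesianProduct⁺ (Unique.allFin⁺ 2)
  (Unique.cartesianProduct⁺ (Unique.allFin⁺ 2) (Unique.cartesianProduct⁺ (Unique.allFin⁺ 3)
    (Unique.cartesianProduct⁺ (Unique.allFin⁺ 3) (Unique.allFin⁺ 3)))))

∈-allExponents : ∀ a → a ∈ withCycles (allFin 3)
∈-allExponents (w , u , v , x , y , z) = ∈-cartesianProduct⁺ (∈-allFin w) (∈-cartesianProduct⁺ (∈-allFin u)
  (∈-cartesianProduct⁺ (∈-allFin v) (∈-cartesianProduct⁺ (∈-allFin x)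
    (∈-cartesianProduct⁺ (∈-allFin y) (∈-allFin z)))))

planeGroup : PermGroup 18
planeGroup = permGroup planes element element-injective ∈-allExponents (withCycles-unique (Unique.allFin⁺ 3))
  (exponents (λ x → x) , element-id)
  (λ a b → element-word (normalForm b) a)
  (λ a → exponents (from (element a)) , element-⁻¹ a)

act∈planeGroup : ∀ a → act a ∈G planeGroup
act∈planeGroup a = ≈⇒conj∈ planes element element-injective ∈-allExponents (element a) (a , λ _ → refl)

planeGroup-transitive : Transitive planeGroup
planeGroup-transitive α β =
  let a , aα≡β = element-transitive (to planes α) (to planes β)
  in  act a , act∈planeGroup a , trans (cong (from planes) aα≡β) (strictlyInverseʳ planes β)

abstract
  planeGroup-stabSize : ∀ ω → stabSize planeGroup ω ≡ 18
  planeGroup-stabSize = toWitness {a? = all? λ ω → stabSize planeGroup ω ℕ.≟ 18} _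

-- a and b agree wherever c = b⁻¹a has a fixed plane. To see that c lies in M, its first exponent is
-- read off as the index of the image of `base`, and a and b both preserve indices.
kernel-intersects : ∀ a b → proj₁ a ≡ 0F → proj₁ b ≡ 0F → Intersect (act a) (act b)
kernel-intersects a b a∈M b∈M = Agree⇒Intersect (act a) (act b) (from planes x , (begin
  act a ⟨$⟩ʳ from planes x                              ≡⟨ conj-from planes (element a) x ⟩
  from planes (to (element a) x)                        ≡⟨ cong (from planes) ax≡bx ⟩
  from planes (to (element b) x)                        ≡⟨ conj-from planes (element b) x ⟨
  act b ⟨$⟩ʳ from planes x                              ∎))
  where
  open ≡-Reasoning

  b⁻¹ = exponents (from (element b))
  quotient = element-word (normalForm b⁻¹) a
  c = proj₁ quotient

  c≈b⁻¹a : ∀ x → to (element c) x ≡ from (element b) (to (element a) x)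
  c≈b⁻¹a x = trans (proj₂ quotient x) (element-⁻¹ b (to (element a) x))

  c∈M : proj₁ c ≡ 0F
  c∈M = begin
    proj₁ c                                             ≡⟨ cong proj₁ (exponents-element c) ⟨
    proj₁ (to (element c) base)                         ≡⟨ cong proj₁ (c≈b⁻¹a base) ⟩
    proj₁ (from (element b) (to (element a) base))      ≡⟨ kernel-fixes-coordinates b b∈M _ ⟨
    proj₁ (to (element b) (from (element b) (to (element a) base)))
      ≡⟨ cong proj₁ (strictlyInverseˡ (element b) (to (element a) base)) ⟩
    proj₁ (to (element a) base)                         ≡⟨ kernel-fixes-coordinates a a∈M base ⟩
    0F                                                  ∎

  fixed = kernel-fixes-plane c c∈M
  x = proj₁ fixed

  ax≡bx : to (element a) x ≡ to (element b) x
  ax≡bx = begin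
    to (element a) x                                    ≡⟨ strictlyInverseˡ (element b) (to (element a) x) ⟨
    to (element b) (from (element b) (to (element a) x)) ≡⟨ cong (to (element b)) (c≈b⁻¹a x) ⟨
    to (element b) (to (element c) x)                   ≡⟨ cong (to (element b)) (proj₂ fixed) ⟩
    to (element b) x                                    ∎

rotation : Fin 3 → Exponents
rotation w = w , 0F , 0F , 0F , 0F , 0F

abstract
  -- `rotation w` acts as ρʷ, which adds w to the index of every plane, so different rotations agree
  -- nowhere.
  rotations-semiregular : ∀ w w′ α → act (rotation w) ⟨$⟩ʳ α ≡ act (rotation w′) ⟨$⟩ʳ α → w ≡ w′
  rotations-semiregular = toWitness {a? = all? λ w → all? λ w′ → all? λ α →
    act (rotation w) ⟨$⟩ʳ α ≟ act (rotation w′) ⟨$⟩ʳ α →-dec w ≟ w′} _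

kernel : List Exponents
kernel = withCycles (0F ∷ [])

∈-kernel : ∀ {a} → a ∈ kernel → proj₁ a ≡ 0F
∈-kernel a∈ with proj₁ (∈-cartesianProduct⁻ (0F ∷ []) signedTranslations a∈)
... | here a₁≡0 = a₁≡0

planeGroup-tight : CliqueCocliqueTight planeGroup 18 108
planeGroup-tight = record
  { transitive      = planeGroup-transitive
  ; stabSize≡       = planeGroup-stabSize
  ; coclique        = map act kernel
  ; clique          = map (act ∘ rotation) (allFin 3)
  ; isCoclique      = ∈-map-elim {P = _∈G planeGroup} act kernel (λ {a} _ → act∈planeGroup a)
                    , conj-distinct planes element element-injective kernel (withCycles-unique (All.[] ∷ []))
                    , intersecting
  ; isClique        = ∈-map-elim {P = _∈G planeGroup} (act ∘ rotation) (allFin 3)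
                        (λ {w} _ → act∈planeGroup (rotation w))
                    , conj-distinct planes (element ∘ rotation)
                        (λ w w′ eq → cong proj₁ (element-injective (rotation w) (rotation w′) eq))
                        (allFin 3) (Unique.allFin⁺ 3)
                    , agree⇒≈
  ; length-coclique = refl
  -- 108 · 3 = 324, by evaluating the lengths of the lists.
  ; tight           = refl
  }
  where
  intersecting : ∀ {x y} → x ∈ map act kernel → y ∈ map act kernel → Intersect x y
  intersecting {y = y} x∈ y∈ = ∈-map-elim {P = λ x → Intersect x y} act kernel (λ {a} a∈ →
    ∈-map-elim {P = Intersect (act a)} act kernel (λ {b} b∈ →
      kernel-intersects a b (∈-kernel a∈) (∈-kernel b∈)) y∈) x∈

  agree⇒≈ : ∀ {x y} → x ∈ map (act ∘ rotation) (allFin 3) → y ∈ map (act ∘ rotation) (allFin 3) →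
    Agree x y → x ≈ₚ y
  agree⇒≈ {y = y} x∈ y∈ = ∈-map-elim {P = λ x → Agree x y → x ≈ₚ y} (act ∘ rotation) (allFin 3) (λ {w} _ →
    ∈-map-elim {P = λ y → Agree (act (rotation w)) y → act (rotation w) ≈ₚ y} (act ∘ rotation) (allFin 3)
      (λ {w′} _ (α , eq) β → cong (λ w → act (rotation w) ⟨$⟩ʳ β) (rotations-semiregular w w′ α eq)) y∈) x∈

-- Examples of unbounded degree

theorem1p3 : ∀ (N : ℕ) → ∃[ n ] (N < n × Σ (PermGroup n) λ G →
    Transitive G × ProductDecomposition G × RhoGtSqrtDegree G)
theorem1p3 N =
  -- The exponent `2 + N` is at least 2, as a product decomposition demands, and makes the degree
  -- exceed `N`.
  18 ^ (2 + N) , <-trans (s≤s (m≤n+m N 1)) (n<m^n 18 (2 + N) (s≤s z<s)) , power 0F planeGroup (2 + N) ,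
  CliqueCocliqueTight.transitive T ,
  (18 , 2 + N , s≤s (s≤s z≤n) , s≤s (s≤s z≤n) ,
    planeGroup , trivial (2 + N) , power≅wreath 0F planeGroup (2 + N)) ,
  -- The base case is 18 · 18² = 5832 < 11664 = 108².
  rho>√degree T (power-bound 18 18 108 (2 + N) (toWitness {a? = 18 * (18 * 18) ℕ.<? 108 * 108} _))
  where
  T = power-tight 0F planeGroup planeGroup-tight (2 + N)
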